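{- Let $n$ and $k$ be integers with $2\leq k\leq n$. For any graph $G$ of order $n$ with complement $\overline{G}$, we have (1) $1\leq \kappa_k(G)+\kappa_k(\overline{G})\leq n-\lceil k/2\rceil$; (2) $0\leq \kappa_k(G)\cdot \kappa_k(\overline{G})\leq \left(\frac{n-\lceil k/2\rceil}{2}\right)^2$. Moreover, the upper and lower bounds are tight: for each of these four bounds there exist $n$, $k$ and a graph $G$ of order $n$ for which the bound is attained with equality.
   Context: All graphs are undirected, finite and simple. For a graph $G$ and a set $S\subseteq V(G)$ of at least two vertices, a tree connecting $S$ is a subgraph $T$ of $G$ that is a tree with $S\subseteq V(T)$. Two trees $T,T'$ connecting $S$ are internally disjoint if $E(T)\cap E(T')=\varnothing$ and $V(T)\cap V(T')=S$. Let $\kappa(S)$ be the maximum number of pairwise internally disjoint trees connecting $S$ in $G$. The generalized $k$-connectivity of $G$ is $\kappa_k(G)=\min\{\kappa(S) : S\subseteq V(G),\ |S|=k\}$, with $\kappa_k(G)=0$ when $G$ is disconnected. -}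

module Defs where

open import Data.Bool.Base using (true; false; if_then_else_)
open import Data.Fin.Base using (Fin; zero; suc)
open import Data.Fin.Properties using (_≟_; all?; injective⇒≤)
open import Data.Fin.Subset using (Subset; _∈_; _⊆_; _∩_; ⊤; ∣_∣; Nonempty)
open import Data.Fin.Subset.Properties using (_∈?_; _⊆?_; nonempty?)
open import Data.List.Base
  using (List; []; _∷_; _∷ʳ_; _++_; [_]; map; filter; length; lookup; allFin;
         cartesianProduct; cartesianProductWith)
open import Data.List.Extrema.Nat using (max; min)
open import Data.List.Membership.Propositional using (lose) renaming (_∈_ to _∈ₗ_)
open import Data.List.Membership.Propositional.Properties
  using (∈-allFin; ∈-lookup; ∈-cartesianProduct⁺; ∈-cartesianProductWith⁺; ∈-filter⁺; ∈-filter⁻)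
open import Data.List.Relation.Unary.All as All using ()
open import Data.List.Relation.Unary.AllPairs using (_∷_; allPairs?)
open import Data.List.Relation.Unary.Any as Any using (here; there; satisfied)
open import Data.List.Relation.Unary.Linked using (Linked; linked?)
open import Data.List.Relation.Unary.Unique.Propositional using (Unique)
open import Data.Nat.Base as ℕ using (ℕ; zero; suc; s≤s; z≤n)
import Data.Nat.Properties as ℕ
open import Data.Product.Base using (_×_; _,_; proj₂; uncurry)
open import Data.Sum.Base using (_⊎_; inj₁; inj₂)
import Data.Vec.Base as Vec
open import Data.Vec.Base using (Vec)
import Data.Vec.Properties as Vec
import Data.Bool.Properties as Bool
open import Function.Base using (_∘_)
open import Level using (0ℓ)
open import Relation.Binary.Construct.Closure.ReflexiveTransitive as Star
  using (Star; ε; _◅_; _◅◅_)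
open import Relation.Binary.Core using (Rel)
open import Relation.Binary.Definitions using (Decidable; Symmetric; Irreflexive)
open import Relation.Binary.PropositionalEquality
  using (_≡_; _≢_; refl; sym; cong)
open import Relation.Nullary.Negation using (contradiction)
open import Relation.Nullary using (Dec; does; ¬_; ¬?)
open import Relation.Nullary.Decidable using (map′; _×-dec_; _⊎-dec_; _→-dec_)

private
  variable
    n : ℕ
    A : Set

record Graph (n : ℕ) : Set₁ where
  infix 4 _~_ _~?_
  field
    _~_      : Rel (Fin n) 0ℓ
    _~?_     : Decidable _~_
    ~-sym    : Symmetric _~_
    ~-irrefl : Irreflexive _≡_ _~_

complement : Graph n → Graph n
complement G = record
  { _~_      = λ u v → u ≢ v × ¬ u ~ v
  ; _~?_     = λ u v → ¬? (u ≟ v) ×-dec ¬? (u ~? v)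
  ; ~-sym    = λ (u≢v , u≁v) → (u≢v ∘ sym) , (u≁v ∘ ~-sym)
  ; ~-irrefl = λ u≡v (u≢v , _) → u≢v u≡v
  }
  where open Graph G

-- The walk is not required to stay in V: this is only used for relations that
-- hold between elements of V alone.
Connected : Rel (Fin n) 0ℓ → Subset n → Set
Connected R V = ∀ u v → u ∈ V → v ∈ V → Star R u v

-- The cycle through the distinct vertices v ∷ vs, closing up from the last
-- of them back to v.
record IsCycle (R : Rel (Fin n) 0ℓ) (v : Fin n) (vs : List (Fin n)) : Set where
  constructor isCycle
  field
    long     : 3 ℕ.≤ length (v ∷ vs)
    distinct : Unique (v ∷ vs)
    closed   : Linked R (v ∷ vs ∷ʳ v)

Acyclic : Rel (Fin n) 0ℓ → Set
Acyclic R = ∀ v vs → ¬ IsCycle R v vs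

-- Raw data of a subgraph on the vertices Fin n: a vertex set, and for each
-- vertex the set of its neighbours.  The conditions making it a subgraph of a
-- given graph are in IsSubgraph.
record Subgraph (n : ℕ) : Set where
  constructor subgraph
  field
    V          : Subset n
    neighbours : Vec (Subset n) n

  E : Rel (Fin n) 0ℓ
  E u v = v ∈ Vec.lookup neighbours u

  E? : Decidable E
  E? u v = v ∈? Vec.lookup neighbours u

open Subgraph

record IsSubgraph (G : Graph n) (T : Subgraph n) : Set where
  constructor isSubgraph
  open Graph G
  field
    E-sym : ∀ u v → E T u v → E T v u
    E⇒V   : ∀ u v → E T u v → u ∈ V T
    E⇒~   : ∀ u v → E T u v → u ~ v

record IsTree (T : Subgraph n) : Set where
  constructor isTree
  field
    nonempty  : Nonempty (V T)
    connected : Connected (E T) (V T)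
    acyclic   : Acyclic (E T)

record IsTreeConnecting (G : Graph n) (S : Subset n) (T : Subgraph n) : Set where
  constructor isTreeConnecting
  field
    isSub  : IsSubgraph G T
    tree   : IsTree T
    covers : S ⊆ V T

InternallyDisjoint : Subset n → Rel (Subgraph n) 0ℓ
InternallyDisjoint S T T′ =
  (∀ u v → ¬ (E T u v × E T′ u v)) × V T ∩ V T′ ≡ S

private
  starIn? : (es : List (Fin n × Fin n)) → Decidable (Star (λ u v → (u , v) ∈ₗ es))
  starIn? []             u v = map′ (λ { refl → ε }) (λ { ε → refl }) (u ≟ v)
  starIn? {n} ((a , b) ∷ es) u v =
    map′ to from (starIn? es u v ⊎-dec (starIn? es u a ×-dec starIn? es b v))
    where
    Old New : Rel (Fin n) 0ℓ
    Old x y = (x , y) ∈ₗ es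
    New x y = (x , y) ∈ₗ ((a , b) ∷ es)

    to : Star Old u v ⊎ (Star Old u a × Star Old b v) → Star New u v
    to (inj₁ p)       = Star.map there p
    to (inj₂ (p , q)) = Star.map there p ◅◅ (here refl ◅ Star.map there q)

    from : ∀ {x y} → Star New x y → Star Old x y ⊎ (Star Old x a × Star Old b y)
    from ε = inj₁ ε
    from (here refl ◅ p) with from p
    ... | inj₁ q       = inj₂ (ε , q)
    ... | inj₂ (_ , q) = inj₂ (ε , q)
    from (there e ◅ p) with from p
    ... | inj₁ q       = inj₁ (e ◅ q)
    ... | inj₂ (q , r) = inj₂ (e ◅ q , r)

  lookup-injective : {xs : List A} → Unique xs → ∀ {i j} →
                     lookup xs i ≡ lookup xs j → i ≡ j
  lookup-injective (x∉xs ∷ _) {zero}  {zero}  _  = refl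
  lookup-injective (x∉xs ∷ _) {zero}  {suc j} eq =
    contradiction eq (All.lookup x∉xs (∈-lookup j))
  lookup-injective (x∉xs ∷ _) {suc i} {zero}  eq =
    contradiction (sym eq) (All.lookup x∉xs (∈-lookup i))
  lookup-injective (_ ∷ u)    {suc i} {suc j} eq = cong suc (lookup-injective u eq)

  listsUpTo : List A → ℕ → List (List A)
  listsUpTo xs zero    = [ [] ]
  listsUpTo xs (suc m) = [] ∷ cartesianProductWith _∷_ xs (listsUpTo xs m)

  ∈-listsUpTo : ∀ {m} (vs : List (Fin n)) → length vs ℕ.≤ m →
                vs ∈ₗ listsUpTo (allFin n) m
  ∈-listsUpTo {m = zero}  []       _         = here refl
  ∈-listsUpTo {m = suc m} []       _         = here refl
  ∈-listsUpTo {m = suc m} (v ∷ vs) (s≤s len) =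
    there (∈-cartesianProductWith⁺ _∷_ (∈-allFin v) (∈-listsUpTo vs len))

module _ {R : Rel (Fin n) 0ℓ} (R? : Decidable R) where

  star? : Decidable (Star R)
  star? u v =
    map′ (Star.map (λ e → proj₂ (∈-filter⁻ (uncurry R?) {xs = pairs} e)))
         (Star.map (λ r → ∈-filter⁺ (uncurry R?)
                            (∈-cartesianProduct⁺ (∈-allFin _) (∈-allFin _)) r))
         (starIn? (filter (uncurry R?) pairs) u v)
    where pairs = cartesianProduct (allFin n) (allFin n)

  connected? : (V : Subset n) → Dec (Connected R V)
  connected? V = all? λ u → all? λ v → (u ∈? V) →-dec ((v ∈? V) →-dec star? u v)

  isCycle? : ∀ v vs → Dec (IsCycle R v vs)
  isCycle? v vs =
    map′ (λ (l , d , c) → isCycle l d c) (λ (isCycle l d c) → l , d , c)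
         (3 ℕ.≤? length (v ∷ vs)
            ×-dec allPairs? (λ x y → ¬? (x ≟ y)) (v ∷ vs)
            ×-dec linked? R? (v ∷ vs ∷ʳ v))

  acyclic? : Dec (Acyclic R)
  acyclic? = all? noCycleAt?
    where
    bounded : ∀ {v vs} → IsCycle R v vs → length vs ℕ.≤ n
    bounded c = ℕ.<⇒≤ (injective⇒≤ (lookup-injective (IsCycle.distinct c)))

    noCycleAt? : ∀ v → Dec (∀ vs → ¬ IsCycle R v vs)
    noCycleAt? v =
      map′ (λ none vs c → none (lose (∈-listsUpTo vs (bounded c)) c))
           (λ none some → uncurry none (satisfied some))
           (¬? (Any.any? (isCycle? v) (listsUpTo (allFin n) n)))

isSubgraph? : (G : Graph n) (T : Subgraph n) → Dec (IsSubgraph G T)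
isSubgraph? G T =
  map′ (λ (s , v , e) → isSubgraph s v e) (λ (isSubgraph s v e) → s , v , e)
       ((all? λ u → all? λ v → E? T u v →-dec E? T v u)
          ×-dec (all? λ u → all? λ v → E? T u v →-dec (u ∈? V T))
          ×-dec (all? λ u → all? λ v → E? T u v →-dec (u ~? v)))
  where open Graph G

isTree? : (T : Subgraph n) → Dec (IsTree T)
isTree? T =
  map′ (λ (ne , c , a) → isTree ne c a) (λ (isTree ne c a) → ne , c , a)
       (nonempty? (V T) ×-dec connected? (E? T) (V T) ×-dec acyclic? (E? T))

isTreeConnecting? : (G : Graph n) (S : Subset n) (T : Subgraph n) →
                    Dec (IsTreeConnecting G S T)
isTreeConnecting? G S T =
  map′ (λ (s , t , c) → isTreeConnecting s t c)
       (λ (isTreeConnecting s t c) → s , t , λ {x} → c {x})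
       (isSubgraph? G T ×-dec isTree? T ×-dec (S ⊆? V T))

internallyDisjoint? : (S : Subset n) → Decidable (InternallyDisjoint S)
internallyDisjoint? S T T′ =
  (all? λ u → all? λ v → ¬? (E? T u v ×-dec E? T′ u v))
    ×-dec Vec.≡-dec Bool._≟_ (V T ∩ V T′) S

vectors : List A → (m : ℕ) → List (Vec A m)
vectors xs zero    = [ Vec.[] ]
vectors xs (suc m) = cartesianProductWith Vec._∷_ xs (vectors xs m)

subsets : (n : ℕ) → List (Subset n)
subsets n = vectors (true ∷ false ∷ []) n

subgraphs : (n : ℕ) → List (Subgraph n)
subgraphs n = cartesianProductWith subgraph (subsets n) (vectors (subsets n) n)

sublists : List A → List (List A)
sublists []       = [ [] ]
sublists (x ∷ xs) = map (x ∷_) (sublists xs) ++ sublists xs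

-- The value at [] is junk; in κ[ k ] on n vertices it is reached only if k > n.
minimum : List ℕ → ℕ
minimum []       = 0
minimum (x ∷ xs) = min x xs

treesConnecting : Graph n → Subset n → List (Subgraph n)
treesConnecting G S = filter (isTreeConnecting? G S) (subgraphs _)

-- Since the sublists include [], the default 0 does not affect the maximum.
κ : Graph n → Subset n → ℕ
κ G S = max 0 (map length
  (filter (allPairs? (internallyDisjoint? S)) (sublists (treesConnecting G S))))

κ[_] : ℕ → Graph n → ℕ
κ[_] {n} k G =
  if does (connected? (Graph._~?_ G) ⊤)
  then minimum (map (κ G) (filter (λ S → ∣ S ∣ ℕ.≟ k) (subsets n)))
  else 0

{-# OPTIONS --safe #-}
module Submission where

-- Upper bounds.  Fix S with k vertices and take internally disjoint trees
-- connecting S in G together with such trees in the complement: they are edge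
-- disjoint, and only this is used (trees of G and of the complement may share
-- vertices outside S).  Give a pair of distinct vertices weight k if it lies in S
-- and k - 1 if it meets S in one vertex.  Orient a tree towards a root, taken
-- outside S if possible; each non-root vertex of S has its own parent edge.  A
-- root outside S gives k edges of weight at least k - 1, and otherwise there are
-- k - 1 edges of weight k: in both cases a tree weighs at least k (k - 1).  The
-- total weight of all pairs is k (k - 1) (n - k / 2), whence at most n - ⌈k/2⌉ trees.
-- Lower bounds.  G or its complement is connected, and then a spanning tree
-- connects every S.
-- Tightness.  On two vertices with k = 2 the bounds on the sum coincide; for the
-- product take k = 3 and the path on four vertices, which is connected along with
-- its complement.

open import Defs
open import Data.Nat using (ℕ; _+_; _*_; _∸_; _≤_; ⌈_/2⌉)
open import Data.Integer using (+_)
open import Data.Rational as ℚ using (_/_)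
open import Data.Product using (_×_; ∃-syntax; Σ-syntax)
open import Relation.Binary.PropositionalEquality using (_≡_)

open import Data.Bool.Base using (true; false; if_then_else_; not)
open import Data.Fin.Base using (Fin; zero; suc; toℕ)
open import Data.Fin.Properties using (_≟_; any?; all?; ¬∀⟶∃¬)
open import Data.Fin.Subset using (Subset; _∈_; ∣_∣; Nonempty; inside; outside; ⊤; ⊥)
open import Data.Fin.Subset.Properties using (_∈?_; nonempty?; Empty-unique; ∣⊥∣≡0; ∈⊤)
import Data.Integer.Base as ℤ
import Data.Integer.Properties as ℤ
open import Data.List.Base using (List; []; _∷_; _∷ʳ_; length; map; filter; _++_)
open import Data.List.Extrema.Nat using (max; argmax-sel; xs≤max; min≤xs; min≤⊤; v≤min⁺)
open import Data.List.Membership.Propositional using () renaming (_∈_ to _∈ₗ_)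
open import Data.List.Membership.Propositional.Properties
  using (∈-map⁺; ∈-map⁻; ∈-++⁺ˡ; ∈-++⁺ʳ; ∈-++⁻; ∈-filter⁺; ∈-cartesianProductWith⁺)
open import Data.List.Properties using (length-++)
open import Data.List.Relation.Unary.All as All using (All; []; _∷_)
import Data.List.Relation.Unary.All.Properties as All
open import Data.List.Relation.Unary.AllPairs as AllPairs using (AllPairs; []; _∷_; allPairs?)
import Data.List.Relation.Unary.AllPairs.Properties as AllPairs
open import Data.List.Relation.Unary.Any using (here; there)
open import Data.List.Relation.Unary.Linked using (Linked; [-]; _∷_)
open import Data.List.Relation.Unary.Unique.Propositional using (Unique)
open import Data.Nat.Base using (zero; suc; NonZero; _<_; ⌊_/2⌋; z≤n; s≤s)
open import Data.Nat.Induction using (<-wellFounded; Acc; acc)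
import Data.Nat.Properties as ℕ
open import Data.Nat.Tactic.RingSolver using (solve-∀)
open import Data.Product using (_,_; proj₁; proj₂)
import Data.Rational.Properties as ℚ
import Data.Rational.Unnormalised.Base as ℚᵘ
import Data.Rational.Unnormalised.Properties as ℚᵘ
open import Data.Sum.Base using (_⊎_; inj₁; inj₂; [_,_]′; swap)
open import Data.Unit.Base using () renaming (⊤ to Unit)
open import Data.Vec.Base as Vec using (Vec; []; _∷_)
import Data.Vec.Properties as Vec
open import Function.Base using (_∘_; id)
open import Level using (0ℓ)
open import Relation.Binary.Construct.Closure.ReflexiveTransitive as Star using (Star; ε; _◅_; _◅◅_)
open import Relation.Binary.Core using (Rel)
open import Relation.Binary.Definitions using (Decidable; Symmetric)
open import Relation.Binary.PropositionalEquality
  using (_≢_; refl; sym; trans; cong; cong₂; subst; subst₂; module ≡-Reasoning)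
open import Relation.Nullary using (Dec; yes; no; does; ¬_; ¬?; contradiction)
open import Relation.Nullary.Decidable
  using (_×-dec_; _⊎-dec_; dec-true; dec-false; decidable-stable; from-yes; toSum)
import Relation.Unary as U
open import Algebra.Properties.Semiring.Sum ℕ.+-*-semiring
  using (sum; sum-cong-≗; ∑-distrib-+; ∑-comm; *-distribˡ-sum; *-distribʳ-sum; sum-replicate-zero)

private
  variable
    n : ℕ
    A P Q : Set

-- Rooted trees

least : {P : ℕ → Set} → U.Decidable P → ∀ m → P m → ∃[ l ] P l × (∀ m → P m → l ≤ m)
least P? zero    p = 0 , p , λ _ _ → z≤n
least P? (suc m) p with P? 0
... | yes p₀ = 0 , p₀ , λ _ _ → z≤n
... | no ¬p₀ with least (P? ∘ suc) m p
...   | l , pₗ , min = suc l , pₗ , λ where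
        zero    p₀ → contradiction p₀ ¬p₀
        (suc m) pₘ → s≤s (min m pₘ)

-- `step` says nothing about the parent of `r` or of a vertex that cannot reach `r`, so both
-- functions can be total.
record SearchTree (R : Rel (Fin n) 0ℓ) (r : Fin n) : Set where
  field
    parent : Fin n → Fin n
    depth  : Fin n → ℕ
    step   : ∀ {u} → Star R u r → u ≢ r → R u (parent u) × depth (parent u) < depth u

module _ {R : Rel (Fin n) 0ℓ} (R? : Decidable R) (r : Fin n) where

  Walk : ℕ → Fin n → Set
  Walk zero    u = u ≡ r
  Walk (suc l) u = ∃[ v ] R u v × Walk l v

  walk? : ∀ l u → Dec (Walk l u)
  walk? zero    u = u ≟ r
  walk? (suc l) u = any? λ v → R? u v ×-dec walk? l v

  fromStar : ∀ {u} → Star R u r → ∃[ l ] Walk l u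
  fromStar ε       = 0 , refl
  fromStar (e ◅ p) with fromStar p
  ... | l , w = suc l , _ , e , w

  shortest : ∀ {u} → Star R u r → ∃[ l ] Walk l u × (∀ m → Walk m u → l ≤ m)
  shortest {u} p with fromStar p
  ... | m , w = least (λ l → walk? l u) m w

  -- The depth is the length of a shortest walk to `r`, and the parent is the next vertex on such a
  -- walk. The rest of the walk starts at the parent, whose depth is therefore smaller.
  breadthFirst : SearchTree R r
  breadthFirst = record { parent = parent ; depth = depth ; step = step }
    where
    parentVia : ∀ l u → Walk l u → Fin n
    parentVia zero    u _       = u
    parentVia (suc l) u (v , _) = v

    parent : Fin n → Fin n
    parent u with star? R? u r
    ... | yes p = let l , w , _ = shortest p in parentVia l u w
    ... | no  _ = u

    depth : Fin n → ℕ
    depth u with star? R? u r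
    ... | yes p = proj₁ (shortest p)
    ... | no  _ = 0

    depth≤ : ∀ {u} l → Walk l u → depth u ≤ l
    depth≤ {u} l w with star? R? u r
    ... | yes p = proj₂ (proj₂ (shortest p)) l w
    -- The default depth `0` makes the bound immediate here.
    ... | no  _ = z≤n

    step : ∀ {u} → Star R u r → u ≢ r → R u (parent u) × depth (parent u) < depth u
    step {u} p u≢r with star? R? u r
    ... | no ¬p = contradiction p ¬p
    ... | yes q with shortest q
    ...   | zero  , u≡r , _         = contradiction u≡r u≢r
    ...   | suc l , (v , e , w) , _ = e , s≤s (depth≤ l w)

module _ (parent : Fin n → Fin n) (depth : Fin n → ℕ) where

  Down : Rel (Fin n) 0ℓ
  Down u v = parent v ≡ u × depth u < depth v

  private
    NonBacktracking : List (Fin n) → Set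
    NonBacktracking (x ∷ xs@(_ ∷ z ∷ _)) = x ≢ z × NonBacktracking xs
    NonBacktracking _                    = Unit

    -- Meant for the tail of a cycle through `v`. The closing `v` could only clash with the entry
    -- two places before it, which `All (_≢ v)` excludes.
    nonBacktracking-∷ʳ : ∀ {v} xs → Unique xs → All (_≢ v) xs → NonBacktracking (xs ∷ʳ v)
    nonBacktracking-∷ʳ []               _                          _               = _
    nonBacktracking-∷ʳ (x ∷ [])         _                          _               = _
    nonBacktracking-∷ʳ (x ∷ y ∷ [])     _                          (x≢v ∷ _)       = x≢v , _
    nonBacktracking-∷ʳ (x ∷ y ∷ z ∷ xs) ((_ ∷ x≢z ∷ _) ∷ distinct) (_ ∷ ≢v)        =
      x≢z , nonBacktracking-∷ʳ (y ∷ z ∷ xs) distinct ≢v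

  -- A cycle does not backtrack, so once a step leads to a child, all later ones do.
  module _ {R : Rel (Fin n) 0ℓ} (upOrDown : ∀ {u v} → R u v → Down v u ⊎ Down u v) where

    private
      -- With every step going down, depth grows all the way to `v`, and the vertex just before `v`
      -- is its parent.
      descend : ∀ {v} x y zs → Down x y → Linked R (y ∷ zs ∷ʳ v) →
                NonBacktracking (x ∷ y ∷ zs ∷ʳ v) → depth x < depth v × parent v ∈ₗ y ∷ zs
      descend x y [] (p , d<) (e ∷ [-]) (x≢v , _) with upOrDown e
      ... | inj₁ (p′ , _)   = contradiction (trans (sym p) p′) x≢v
      ... | inj₂ (p′ , d<′) = ℕ.<-trans d< d<′ , here p′
      descend x y (z ∷ zs) (p , d<) (e ∷ es) (x≢z , nb) with upOrDown e
      ... | inj₁ (p′ , _) = contradiction (trans (sym p) p′) x≢z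
      ... | inj₂ down with descend y z zs down es nb
      ...   | d<′ , p∈ = ℕ.<-trans d< d<′ , there p∈

      -- Either all steps go up, and depth falls as far as `v`, or some step goes down, and from
      -- there on the walk descends and enters `v` from its parent.
      ascend : ∀ {v} x y ys → Linked R (x ∷ y ∷ ys ∷ʳ v) → NonBacktracking (x ∷ y ∷ ys ∷ʳ v) →
               depth v < depth x ⊎ parent v ∈ₗ y ∷ ys
      ascend x y ys       (e ∷ es)       nb       with upOrDown e
      ascend x y ys       (e ∷ es)       nb       | inj₂ down = inj₂ (proj₂ (descend x y ys down es nb))
      ascend x y []       (e ∷ e′ ∷ [-]) nb       | inj₁ (_ , d<) with upOrDown e′
      ... | inj₁ (_ , d<′) = inj₁ (ℕ.<-trans d<′ d<)
      ... | inj₂ (p , _)   = inj₂ (here p)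
      ascend x y (z ∷ zs) (e ∷ es)       (_ , nb) | inj₁ (_ , d<) with ascend y z zs es nb
      ... | inj₁ d<′ = inj₁ (ℕ.<-trans d<′ d<)
      ... | inj₂ p∈  = inj₂ (there p∈)

    -- If the first step goes down, depth increases all the way round, which is absurd. If it goes
    -- up, it leads to the parent `a` of `v`. The rest of the cycle cannot only climb, as `v` is
    -- deeper than `a`, so it enters `v` from its parent and `a` occurs twice.
    parents⇒acyclic : Acyclic R
    parents⇒acyclic v []           (isCycle (s≤s ()) _ _)
    parents⇒acyclic v (a ∷ [])     (isCycle (s≤s (s≤s ())) _ _)
    parents⇒acyclic v (a ∷ b ∷ cs) (isCycle _ (v≢@(_ ∷ v≢b ∷ _) ∷ distinct@(a≢ ∷ _)) (e ∷ es))
      with upOrDown e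
         | nonBacktracking-∷ʳ (a ∷ b ∷ cs) distinct (All.map (_∘ sym) v≢)
    ... | inj₂ down       | nb = ℕ.<-irrefl refl (proj₁ (descend v a (b ∷ cs) down es (v≢b , nb)))
    ... | inj₁ (p≡a , d<) | nb with ascend a b cs es nb
    ...   | inj₁ d<′ = ℕ.<-asym d< d<′
    ...   | inj₂ p∈  = contradiction (sym p≡a) (All.lookup a≢ p∈)

-- Spanning trees of connected graphs

module _ {R : Rel (Fin n) 0ℓ} (R? : Decidable R) where

  tabulateNeighbours : Vec (Subset n) n
  tabulateNeighbours = Vec.tabulate λ u → Vec.tabulate λ v → does (R? u v)

  lookup-neighbours : ∀ u v → Vec.lookup (Vec.lookup tabulateNeighbours u) v ≡ does (R? u v)
  lookup-neighbours u v = trans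
    (cong (λ N → Vec.lookup N v) (Vec.lookup∘tabulate _ u)) (Vec.lookup∘tabulate _ v)

  ∈-tabulate⁺ : ∀ {u v} → R u v → v ∈ Vec.lookup tabulateNeighbours u
  ∈-tabulate⁺ {u} {v} e = Vec.lookup⇒[]= v _ (begin
    Vec.lookup (Vec.lookup tabulateNeighbours u) v ≡⟨ lookup-neighbours u v ⟩
    does (R? u v)                                  ≡⟨ dec-true (R? u v) e ⟩
    true                                           ∎)
    where open ≡-Reasoning

  ∈-tabulate⁻ : ∀ {u v} → v ∈ Vec.lookup tabulateNeighbours u → R u v
  ∈-tabulate⁻ {u} {v} v∈ with R? u v | trans (sym (lookup-neighbours u v)) (Vec.[]=⇒lookup v∈)
  ... | yes e | _ = e

module _ (G : Graph n) (connected : Connected (Graph._~_ G) ⊤) (r : Fin n) where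
  open Graph G

  private
    open SearchTree (breadthFirst _~?_ r)

    -- The root is left out because `step` gives no information on `parent r`.
    ParentOf : Rel (Fin n) 0ℓ
    ParentOf u v = v ≢ r × parent v ≡ u

    parentOf? : Decidable ParentOf
    parentOf? u v = ¬? (v ≟ r) ×-dec parent v ≟ u

    edge? : Decidable (λ u v → ParentOf v u ⊎ ParentOf u v)
    edge? u v = parentOf? v u ⊎-dec parentOf? u v

    toRoot : ∀ u → Star _~_ u r
    toRoot u = connected u r ∈⊤ ∈⊤

    parentOf⇒Down : ∀ {u v} → ParentOf u v → Down parent depth u v
    parentOf⇒Down (v≢r , refl) = refl , proj₂ (step (toRoot _) v≢r)

    parentOf⇒~ : ∀ {u v} → ParentOf u v → v ~ u
    parentOf⇒~ (v≢r , refl) = proj₁ (step (toRoot _) v≢r)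

  spanningTree : Subgraph n
  spanningTree = subgraph ⊤ (tabulateNeighbours edge?)

  -- Following parents reaches `r` because depth decreases, and every edge joins a vertex to its
  -- parent, which excludes cycles. The vertex set is `⊤`, so one tree serves every `S`.
  spanningTree-connecting : ∀ S → IsTreeConnecting G S spanningTree
  spanningTree-connecting S = isTreeConnecting
    (isSubgraph (λ u v e → E-sym e) (λ _ _ _ → ∈⊤)
      (λ u v e → [ parentOf⇒~ , ~-sym ∘ parentOf⇒~ ]′ (∈-tabulate⁻ edge? e)))
    (isTree (r , ∈⊤)
      (λ u v _ _ → climb u (<-wellFounded _) ◅◅ Star.reverse E-sym (climb v (<-wellFounded _)))
      (parents⇒acyclic parent depth ([ inj₁ ∘ parentOf⇒Down , inj₂ ∘ parentOf⇒Down ]′ ∘ ∈-tabulate⁻ edge?)))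
    (λ _ → ∈⊤)
    where
    open Subgraph spanningTree using (E)

    E-sym : Symmetric E
    E-sym e = ∈-tabulate⁺ edge? ([ inj₂ , inj₁ ]′ (∈-tabulate⁻ edge? e))

    climb : ∀ u → Acc _<_ (depth u) → Star E u r
    climb u (acc rec) with u ≟ r
    ... | yes refl = ε
    ... | no u≢r   = ∈-tabulate⁺ edge? (inj₁ (u≢r , refl)) ◅ climb (parent u) (rec (proj₂ (step (toRoot u) u≢r)))

-- If `u` does not reach `v` in `G`, the complement joins every vertex reachable from `u` to every
-- unreachable one. Two vertices on opposite sides are then adjacent; two on the same side have `v`
-- or `u` as a common neighbour.
connectedOrComplement : (G : Graph n) →
  Connected (Graph._~_ G) ⊤ ⊎ Connected (Graph._~_ (complement G)) ⊤
connectedOrComplement {n} G with connected? (Graph._~?_ G) ⊤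
... | yes connected = inj₁ connected
... | no ¬connected = inj₂ (λ x y _ _ → linked x y)
  where
  open Graph G
  module Ḡ = Graph (complement G)

  separated : ∃[ u ] ∃[ v ] ¬ Star _~_ u v
  separated with ¬∀⟶∃¬ n (λ u → ∀ v → Star _~_ u v) (λ u → all? (star? _~?_ u))
                         (λ all → ¬connected λ u v _ _ → all u v)
  ... | u , ¬all with ¬∀⟶∃¬ n (Star _~_ u) (star? _~?_ u) ¬all
  ...   | v , ¬uv = u , v , ¬uv

  u v : Fin n
  u = proj₁ separated
  v = proj₁ (proj₂ separated)

  across : ∀ {x y} → Star _~_ u x → ¬ Star _~_ u y → x Ḡ.~ y
  across ux ¬uy = (λ { refl → ¬uy ux }) , (λ x~y → ¬uy (ux ◅◅ (x~y ◅ ε)))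

  linked : ∀ x y → Star Ḡ._~_ x y
  linked x y with star? _~?_ u x | star? _~?_ u y
  ... | yes ux | no ¬uy = across ux ¬uy ◅ ε
  ... | no ¬ux | yes uy = Ḡ.~-sym (across uy ¬ux) ◅ ε
  ... | yes ux | yes uy = across ux ¬uv ◅ Ḡ.~-sym (across uy ¬uv) ◅ ε
    where ¬uv = proj₂ (proj₂ separated)
  ... | no ¬ux | no ¬uy = Ḡ.~-sym (across ε ¬ux) ◅ across ε ¬uy ◅ ε

-- Counting edges at S

-- A common host for trees of a graph and trees of its complement, so that they can be counted
-- together.
complete : ∀ n → Graph n
complete n = record
  { _~_      = _≢_
  ; _~?_     = λ u v → ¬? (u ≟ v)
  ; ~-sym    = _∘ sym
  ; ~-irrefl = λ u≡v u≢v → u≢v u≡v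
  }

EdgeDisjoint : ∀ {n} → Rel (Subgraph n) 0ℓ
EdgeDisjoint T T′ = ∀ u v → ¬ (E T u v × E T′ u v)
  where open Subgraph

𝟙 : Dec P → ℕ
𝟙 P? = if does P? then 1 else 0

𝟙-true : (P? : Dec P) → P → 𝟙 P? ≡ 1
𝟙-true P? p = cong (if_then 1 else 0) (dec-true P? p)

𝟙-false : (P? : Dec P) → ¬ P → 𝟙 P? ≡ 0
𝟙-false P? ¬p = cong (if_then 1 else 0) (dec-false P? ¬p)

𝟙-× : (P? : Dec P) (Q? : Dec Q) → 𝟙 (P? ×-dec Q?) ≡ 𝟙 P? * 𝟙 Q?
𝟙-× P? Q? with does P?
... | true  = sym (ℕ.+-identityʳ _)
... | false = refl

𝟙-disjoint : {R : Set} (P? : Dec P) (Q? : Dec Q) (R? : Dec R) →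
             (P → R) → (Q → R) → (P → ¬ Q) → 𝟙 P? + 𝟙 Q? ≤ 𝟙 R?
𝟙-disjoint (yes p) Q? R? p→r q→r p→¬q =
  ℕ.≤-reflexive (trans (cong suc (𝟙-false Q? (p→¬q p))) (sym (𝟙-true R? (p→r p))))
𝟙-disjoint (no _) (yes q) R? p→r q→r p→¬q = ℕ.≤-reflexive (sym (𝟙-true R? (q→r q)))
𝟙-disjoint (no _) (no _)  R? p→r q→r p→¬q = z≤n

sum-mono : {f g : Fin n → ℕ} → (∀ i → f i ≤ g i) → sum f ≤ sum g
sum-mono {zero}  f≤g = z≤n
sum-mono {suc n} f≤g = ℕ.+-mono-≤ (f≤g zero) (sum-mono (f≤g ∘ suc))

sum-ones : ∀ n → sum {n} (λ _ → 1) ≡ n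
sum-ones zero    = refl
sum-ones (suc n) = cong suc (sum-ones n)

∑∈ : (S : Subset n) → sum (λ i → 𝟙 (i ∈? S)) ≡ ∣ S ∣
∑∈ []            = refl
∑∈ (inside  ∷ S) = cong suc (∑∈ S)
∑∈ (outside ∷ S) = ∑∈ S

∑-select : (f : Fin n → ℕ) (i : Fin n) → sum (λ j → 𝟙 (i ≟ j) * f j) ≡ f i
∑-select {suc n} f zero    = trans (cong₂ _+_ (ℕ.*-identityˡ (f zero)) (sum-replicate-zero n)) (ℕ.+-identityʳ (f zero))
∑-select {suc n} f (suc i) = ∑-select (f ∘ suc) i

∑∑-product : ∀ n (f g : Fin n → ℕ) → sum (λ i → sum (λ j → f i * g j)) ≡ sum f * sum g
∑∑-product n f g = trans (sum-cong-≗ λ i → sym (*-distribˡ-sum (f i) g)) (sym (*-distribʳ-sum (sum g) f))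

∑∑-distrib-+ : ∀ n (f g : Fin n → Fin n → ℕ) →
  sum (λ i → sum λ j → f i j + g i j) ≡ sum (λ i → sum (f i)) + sum (λ i → sum (g i))
∑∑-distrib-+ n f g = trans (sum-cong-≗ λ i → ∑-distrib-+ (f i) (g i)) (∑-distrib-+ (sum ∘ f) (sum ∘ g))

∑∑-distribˡ : ∀ n x (f : Fin n → Fin n → ℕ) → sum (λ i → sum λ j → x * f i j) ≡ x * sum (λ i → sum (f i))
∑∑-distribˡ n x f = trans (sum-cong-≗ λ i → sym (*-distribˡ-sum x (f i))) (sym (*-distribˡ-sum x (sum ∘ f)))

-- `suc m` is the size k of `S` and `c` the number of vertices outside it. With these parameters k -
-- 1 and n - k involve no truncated subtraction.
module Counting {n : ℕ} (S : Subset n) (m c : ℕ) (∣S∣≡1+m : ∣ S ∣ ≡ suc m) (n≡ : n ≡ suc m + c) where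

  inS outS : Fin n → ℕ
  inS  u = 𝟙 (u ∈? S)
  outS u = 𝟙 (¬? (u ∈? S))

  -- k for a pair inside S, k - 1 for a pair meeting S in one vertex, where k = suc m;
  -- sums run over ordered pairs, so every edge counts twice.
  W : Fin n → Fin n → ℕ
  W u v = suc m * (inS u * inS v) + m * (inS u * outS v + outS u * inS v)

  in+out : ∀ u → inS u + outS u ≡ 1
  in+out u with does (u ∈? S)
  ... | true  = refl
  ... | false = refl

  ∑in : sum inS ≡ suc m
  ∑in = trans (∑∈ S) ∣S∣≡1+m

  ∑out : sum outS ≡ c
  ∑out = ℕ.+-cancelˡ-≡ (suc m) _ _ (begin
    suc m + sum outS           ≡⟨ cong (_+ sum outS) ∑in ⟨
    sum inS + sum outS         ≡⟨ ∑-distrib-+ inS outS ⟨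
    sum (λ u → inS u + outS u) ≡⟨ sum-cong-≗ {n} in+out ⟩
    sum {n} (λ _ → 1)          ≡⟨ sum-ones n ⟩
    n                          ≡⟨ n≡ ⟩
    suc m + c                  ∎)
    where open ≡-Reasoning

  W-sym : ∀ u v → W u v ≡ W v u
  W-sym u v = eq m (inS u) (outS u) (inS v) (outS v)
    where
    eq : ∀ m a b a′ b′ → suc m * (a * a′) + m * (a * b′ + b * a′) ≡ suc m * (a′ * a) + m * (a′ * b + b′ * a)
    eq = solve-∀

  W-diagonal : ∀ u → W u u ≡ suc m * inS u
  W-diagonal u with does (u ∈? S)
  ... | true  = eq m where
    eq : ∀ m → suc m * 1 + m * 0 ≡ suc m * 1
    eq = solve-∀
  ... | false = eq m where
    eq : ∀ m → suc m * 0 + m * 0 ≡ suc m * 0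
    eq = solve-∀

  W-∈-∈ : ∀ {u v} → u ∈ S → v ∈ S → W u v ≡ suc m
  W-∈-∈ {u} {v} u∈ v∈ rewrite dec-true (u ∈? S) u∈ | dec-true (v ∈? S) v∈ = eq m where
    eq : ∀ m → suc m * 1 + m * 0 ≡ suc m
    eq = solve-∀

  W-∈ : ∀ {u} v → u ∈ S → m ≤ W u v
  W-∈ {u} v u∈ with v ∈? S
  ... | yes v∈ rewrite dec-true (u ∈? S) u∈ = ℕ.≤-trans (ℕ.≤-trans (ℕ.n≤1+n m) (ℕ.≤-reflexive (sym (ℕ.*-identityʳ (suc m))))) (ℕ.m≤m+n _ _)
  ... | no  v∉ rewrite dec-true (u ∈? S) u∈ = ℕ.≤-trans (ℕ.≤-reflexive (sym (ℕ.*-identityʳ m))) (ℕ.m≤n+m _ _)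

  -- Over all ordered pairs the sum factors into products of `sum inS` and `sum outS`. The diagonal
  -- accounts for `suc m * suc m`, which is added to both sides and cancelled. With n = k + c the
  -- result is twice k (k - 1) (n - k / 2).
  pairTotal : sum (λ u → sum λ v → 𝟙 (¬? (u ≟ v)) * W u v) ≡ m * suc m * (suc m + 2 * c)
  pairTotal = ℕ.+-cancelˡ-≡ (suc m * suc m) _ _ (begin
    suc m * suc m + sum (λ u → sum λ v → 𝟙 (¬? (u ≟ v)) * W u v)
      ≡⟨ cong (_+ sum (λ u → sum λ v → 𝟙 (¬? (u ≟ v)) * W u v)) diagonal ⟨
    sum (λ u → sum λ v → 𝟙 (u ≟ v) * W u v) + sum (λ u → sum λ v → 𝟙 (¬? (u ≟ v)) * W u v)
      ≡⟨ ∑∑-distrib-+ n _ _ ⟨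
    sum (λ u → sum λ v → 𝟙 (u ≟ v) * W u v + 𝟙 (¬? (u ≟ v)) * W u v)
      ≡⟨ sum-cong-≗ (λ u → sum-cong-≗ (λ v → split (does (u ≟ v)) (W u v))) ⟩
    sum (λ u → sum (W u))
      ≡⟨ ∑∑-distrib-+ n _ _ ⟩
    sum (λ u → sum λ v → suc m * (inS u * inS v)) + sum (λ u → sum λ v → m * (inS u * outS v + outS u * inS v))
      ≡⟨ cong₂ _+_ (∑∑-distribˡ n (suc m) _) (∑∑-distribˡ n m _) ⟩
    suc m * sum (λ u → sum λ v → inS u * inS v) + m * sum (λ u → sum λ v → inS u * outS v + outS u * inS v)
      ≡⟨ cong₂ (λ x y → suc m * x + m * y) (∑∑-product n inS inS)
           (trans (∑∑-distrib-+ n _ _) (cong₂ _+_ (∑∑-product n inS outS) (∑∑-product n outS inS))) ⟩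
    suc m * (sum inS * sum inS) + m * (sum inS * sum outS + sum outS * sum inS)
      ≡⟨ cong₂ (λ x y → suc m * (x * x) + m * (x * y + y * x)) ∑in ∑out ⟩
    suc m * (suc m * suc m) + m * (suc m * c + c * suc m)
      ≡⟨ eq m c ⟩
    suc m * suc m + m * suc m * (suc m + 2 * c) ∎)
    where
    open ≡-Reasoning

    eq : ∀ m c → suc m * (suc m * suc m) + m * (suc m * c + c * suc m) ≡ suc m * suc m + m * suc m * (suc m + 2 * c)
    eq = solve-∀

    split : ∀ b x → (if b then 1 else 0) * x + (if not b then 1 else 0) * x ≡ x
    split true  x = trans (ℕ.+-identityʳ _) (ℕ.*-identityˡ x)
    split false x = ℕ.*-identityˡ x

    diagonal : sum (λ u → sum λ v → 𝟙 (u ≟ v) * W u v) ≡ suc m * suc m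
    diagonal = begin
      sum (λ u → sum λ v → 𝟙 (u ≟ v) * W u v) ≡⟨ sum-cong-≗ (λ u → ∑-select (W u) u) ⟩
      sum (λ u → W u u)                       ≡⟨ sum-cong-≗ W-diagonal ⟩
      sum (λ u → suc m * inS u)               ≡⟨ *-distribˡ-sum (suc m) inS ⟨
      suc m * sum inS                         ≡⟨ cong (suc m *_) ∑in ⟩
      suc m * suc m                           ∎

  treeWeight : Subgraph n → ℕ
  treeWeight T = sum λ u → sum λ v → 𝟙 (Subgraph.E? T u v) * W u v

  S-nonempty : Nonempty S
  S-nonempty with nonempty? S
  ... | yes ne = ne
  ... | no ¬ne = contradiction (trans (sym ∣S∣≡1+m) (trans (cong ∣_∣ (Empty-unique ¬ne)) (∣⊥∣≡0 n))) λ ()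

  module _ {T : Subgraph n} (T-tree : IsTreeConnecting (complete n) S T) where
    open Subgraph T
    open IsTreeConnecting T-tree
    open IsSubgraph isSub
    open IsTree tree

    module _ {r : Fin n} (r∈V : r ∈ V) where
      open SearchTree (breadthFirst E? r)

      NonRoot? : ∀ u → Dec (u ∈ S × u ≢ r)
      NonRoot? u = (u ∈? S) ×-dec ¬? (u ≟ r)

      ParentEdge : Rel (Fin n) 0ℓ
      ParentEdge u v = (u ∈ S × u ≢ r) × parent u ≡ v

      parentEdge? : Decidable ParentEdge
      parentEdge? u v = NonRoot? u ×-dec (parent u ≟ v)

      stepS : ∀ {u} → u ∈ S × u ≢ r → E u (parent u) × depth (parent u) < depth u
      stepS (u∈S , u≢r) = step (connected _ r (covers u∈S) r∈V) u≢r

      -- Only the vertices of `S` are charged for their parent edges; any other edge of the tree can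
      -- only add to its weight.
      parentWeight : ℕ
      parentWeight = sum λ u → 𝟙 (NonRoot? u) * W u (parent u)

      -- Each charged edge appears in `treeWeight` as two ordered pairs, one per direction. No pair
      -- is counted twice, since by depth two vertices cannot be each other's parents.
      2*parentWeight≤treeWeight : 2 * parentWeight ≤ treeWeight T
      2*parentWeight≤treeWeight = begin
        2 * parentWeight
          ≡⟨ cong (λ x → parentWeight + x) (ℕ.+-identityʳ parentWeight) ⟩
        parentWeight + parentWeight
          ≡⟨ cong₂ _+_ (sum-cong-≗ row) (sym column) ⟨
        sum (λ u → sum λ v → 𝟙 (parentEdge? u v) * W u v) + sum (λ u → sum λ v → 𝟙 (parentEdge? v u) * W u v)
          ≡⟨ ∑∑-distrib-+ n _ _ ⟨
        sum (λ u → sum λ v → 𝟙 (parentEdge? u v) * W u v + 𝟙 (parentEdge? v u) * W u v)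
          ≤⟨ sum-mono (λ u → sum-mono λ v → ℕ.≤-trans
               (ℕ.≤-reflexive (sym (ℕ.*-distribʳ-+ (W u v) (𝟙 (parentEdge? u v)) (𝟙 (parentEdge? v u)))))
               (ℕ.*-monoˡ-≤ (W u v) (parent≤edge u v))) ⟩
        treeWeight T ∎
        where
        open ℕ.≤-Reasoning

        row : ∀ u → sum (λ v → 𝟙 (parentEdge? u v) * W u v) ≡ 𝟙 (NonRoot? u) * W u (parent u)
        row u = begin-equality
          sum (λ v → 𝟙 (parentEdge? u v) * W u v)
            ≡⟨ sum-cong-≗ (λ v → trans (cong (_* W u v) (𝟙-× (NonRoot? u) (parent u ≟ v))) (ℕ.*-assoc (𝟙 (NonRoot? u)) _ _)) ⟩
          sum (λ v → 𝟙 (NonRoot? u) * (𝟙 (parent u ≟ v) * W u v))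
            ≡⟨ *-distribˡ-sum (𝟙 (NonRoot? u)) (λ v → 𝟙 (parent u ≟ v) * W u v) ⟨
          𝟙 (NonRoot? u) * sum (λ v → 𝟙 (parent u ≟ v) * W u v)
            ≡⟨ cong (𝟙 (NonRoot? u) *_) (∑-select (W u) (parent u)) ⟩
          𝟙 (NonRoot? u) * W u (parent u) ∎

        column : parentWeight ≡ sum (λ u → sum λ v → 𝟙 (parentEdge? v u) * W u v)
        column = begin-equality
          parentWeight
            ≡⟨ sum-cong-≗ row ⟨
          sum (λ u → sum λ v → 𝟙 (parentEdge? u v) * W u v)
            ≡⟨ ∑-comm {n} {n} (λ u v → 𝟙 (parentEdge? u v) * W u v) ⟩
          sum (λ v → sum λ u → 𝟙 (parentEdge? u v) * W u v)
            ≡⟨ sum-cong-≗ (λ v → sum-cong-≗ λ u → cong (𝟙 (parentEdge? u v) *_) (W-sym u v)) ⟩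
          sum (λ u → sum λ v → 𝟙 (parentEdge? v u) * W u v) ∎

        parent≤edge : ∀ u v → 𝟙 (parentEdge? u v) + 𝟙 (parentEdge? v u) ≤ 𝟙 (E? u v)
        parent≤edge u v = 𝟙-disjoint (parentEdge? u v) (parentEdge? v u) (E? u v)
          (λ { (nr , refl) → proj₁ (stepS nr) })
          (λ { (nr , refl) → E-sym _ _ (proj₁ (stepS nr)) })
          (λ { (nr , refl) (nr′ , p) → ℕ.<-asym (proj₂ (stepS nr))
                 (subst (λ w → depth w < depth v) p (proj₂ (stepS nr′))) })

      -- No vertex of `S` is the root, so all `suc m` of them are charged, each for an edge that
      -- meets `S` and so weighs at least `m`.
      outerRoot : ¬ r ∈ S → m * suc m ≤ parentWeight
      outerRoot r∉S = begin
        m * suc m                 ≡⟨ cong (m *_) ∑in ⟨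
        m * sum inS               ≡⟨ *-distribˡ-sum m inS ⟩
        sum (λ u → m * inS u)     ≤⟨ sum-mono pointwise ⟩
        parentWeight              ∎
        where
        open ℕ.≤-Reasoning
        pointwise : ∀ u → m * inS u ≤ 𝟙 (NonRoot? u) * W u (parent u)
        pointwise u with toSum (u ∈? S)
        ... | inj₂ u∉S = begin
          m * inS u ≡⟨ cong (m *_) (𝟙-false (u ∈? S) u∉S) ⟩
          m * 0     ≡⟨ ℕ.*-zeroʳ m ⟩
          0         ≤⟨ z≤n ⟩
          𝟙 (NonRoot? u) * W u (parent u) ∎
        ... | inj₁ u∈S = begin
          m * inS u                       ≡⟨ cong (m *_) (𝟙-true (u ∈? S) u∈S) ⟩
          m * 1                           ≡⟨ ℕ.*-comm m 1 ⟩
          1 * m                           ≤⟨ ℕ.*-monoʳ-≤ 1 (W-∈ (parent u) u∈S) ⟩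
          1 * W u (parent u)              ≡⟨ cong (_* W u (parent u)) (𝟙-true (NonRoot? u) (u∈S , λ { refl → r∉S u∈S })) ⟨
          𝟙 (NonRoot? u) * W u (parent u) ∎

      -- Every charged edge lies inside `S` and weighs `suc m`. The root is not charged; adding
      -- `suc m` on its behalf to both sides allows a comparison vertex by vertex.
      innerRoot : (∀ {v} → v ∈ V → v ∈ S) → m * suc m ≤ parentWeight
      innerRoot V⊆S = ℕ.+-cancelʳ-≤ (suc m) _ _ (begin
        m * suc m + suc m         ≡⟨ ℕ.+-comm _ (suc m) ⟩
        suc m * suc m             ≡⟨ cong (suc m *_) ∑in ⟨
        suc m * sum inS           ≡⟨ *-distribˡ-sum (suc m) inS ⟩
        sum (λ u → suc m * inS u) ≤⟨ sum-mono pointwise ⟩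
        sum (λ u → 𝟙 (NonRoot? u) * W u (parent u) + 𝟙 (r ≟ u) * suc m)
          ≡⟨ ∑-distrib-+ {n} _ _ ⟩
        parentWeight + sum (λ u → 𝟙 (r ≟ u) * suc m)
          ≡⟨ cong (λ x → parentWeight + x) (∑-select (λ _ → suc m) r) ⟩
        parentWeight + suc m      ∎)
        where
        open ℕ.≤-Reasoning
        pointwise : ∀ u → suc m * inS u ≤ 𝟙 (NonRoot? u) * W u (parent u) + 𝟙 (r ≟ u) * suc m
        pointwise u with toSum (u ∈? S) | toSum (r ≟ u)
        ... | inj₂ u∉S | _ = begin
          suc m * inS u ≡⟨ cong (suc m *_) (𝟙-false (u ∈? S) u∉S) ⟩
          suc m * 0     ≡⟨ ℕ.*-zeroʳ (suc m) ⟩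
          0             ≤⟨ z≤n ⟩
          𝟙 (NonRoot? u) * W u (parent u) + 𝟙 (r ≟ u) * suc m ∎
        ... | inj₁ u∈S | inj₁ r≡u = begin
          suc m * inS u       ≡⟨ cong (suc m *_) (𝟙-true (u ∈? S) u∈S) ⟩
          suc m * 1           ≡⟨ ℕ.*-comm (suc m) 1 ⟩
          1 * suc m           ≡⟨ cong (_* suc m) (𝟙-true (r ≟ u) r≡u) ⟨
          𝟙 (r ≟ u) * suc m   ≤⟨ ℕ.m≤n+m _ _ ⟩
          𝟙 (NonRoot? u) * W u (parent u) + 𝟙 (r ≟ u) * suc m ∎
        ... | inj₁ u∈S | inj₂ r≢u = begin
          suc m * inS u                   ≡⟨ cong (suc m *_) (𝟙-true (u ∈? S) u∈S) ⟩
          suc m * 1                       ≡⟨ ℕ.*-comm (suc m) 1 ⟩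
          1 * suc m                       ≡⟨ cong (1 *_) (W-∈-∈ u∈S parent∈S) ⟨
          1 * W u (parent u)              ≡⟨ cong (_* W u (parent u)) (𝟙-true (NonRoot? u) (u∈S , r≢u ∘ sym)) ⟨
          𝟙 (NonRoot? u) * W u (parent u) ≤⟨ ℕ.m≤m+n _ _ ⟩
          𝟙 (NonRoot? u) * W u (parent u) + 𝟙 (r ≟ u) * suc m ∎
          where parent∈S = V⊆S (E⇒V _ _ (E-sym _ _ (proj₁ (stepS (u∈S , r≢u ∘ sym)))))

    rooted⇒treeWeight≥ : ∀ {r} (r∈V : r ∈ V) → m * suc m ≤ parentWeight r∈V → 2 * (m * suc m) ≤ treeWeight T
    rooted⇒treeWeight≥ r∈V ≤parents = ℕ.≤-trans (ℕ.*-monoʳ-≤ 2 ≤parents) (2*parentWeight≤treeWeight r∈V)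

    -- If no vertex of the tree is available as a root outside `S`, the tree lives on `S`, and any
    -- vertex of `S` can be the root. The factor 2 reflects the ordered pairs.
    treeWeight≥ : 2 * (m * suc m) ≤ treeWeight T
    treeWeight≥ with any? (λ v → (v ∈? V) ×-dec ¬? (v ∈? S))
    ... | yes (r , r∈V , r∉S) = rooted⇒treeWeight≥ r∈V (outerRoot r∈V r∉S)
    ... | no ¬outer =
      let r , r∈S = S-nonempty in
      rooted⇒treeWeight≥ (covers r∈S) (innerRoot (covers r∈S) λ {v} v∈V →
        decidable-stable (v ∈? S) λ v∉S → ¬outer (v , v∈V , v∉S))

  multiplicity : List (Subgraph n) → Fin n → Fin n → ℕ
  multiplicity []       u v = 0
  multiplicity (T ∷ Ts) u v = 𝟙 (Subgraph.E? T u v) + multiplicity Ts u v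

  totalWeight≥ : ∀ {Ts} → All (IsTreeConnecting (complete n) S) Ts →
    length Ts * (2 * (m * suc m)) ≤ sum (λ u → sum λ v → multiplicity Ts u v * W u v)
  totalWeight≥ []                   = z≤n
  totalWeight≥ {T ∷ Ts} (T-tree ∷ trees) = begin
    2 * (m * suc m) + length Ts * (2 * (m * suc m))
      ≤⟨ ℕ.+-mono-≤ (treeWeight≥ T-tree) (totalWeight≥ trees) ⟩
    treeWeight T + sum (λ u → sum λ v → multiplicity Ts u v * W u v)
      ≡⟨ ∑∑-distrib-+ n _ _ ⟨
    sum (λ u → sum λ v → 𝟙 (Subgraph.E? T u v) * W u v + multiplicity Ts u v * W u v)
      ≡⟨ sum-cong-≗ (λ u → sum-cong-≗ λ v → ℕ.*-distribʳ-+ (W u v) (𝟙 (Subgraph.E? T u v)) (multiplicity Ts u v)) ⟨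
    sum (λ u → sum λ v → multiplicity (T ∷ Ts) u v * W u v) ∎
    where open ℕ.≤-Reasoning

  multiplicity≡0 : ∀ {Ts u v} → All (λ T → ¬ Subgraph.E T u v) Ts → multiplicity Ts u v ≡ 0
  multiplicity≡0 []                  = refl
  multiplicity≡0 {T ∷ _} {u} {v} (¬e ∷ ¬es) = cong₂ _+_ (𝟙-false (Subgraph.E? T u v) ¬e) (multiplicity≡0 ¬es)

  -- An edge of one tree is an edge of no later one, and a subgraph of `complete n` has no loops.
  multiplicity≤ : ∀ {Ts} → All (IsTreeConnecting (complete n) S) Ts → AllPairs EdgeDisjoint Ts →
    ∀ u v → multiplicity Ts u v ≤ 𝟙 (¬? (u ≟ v))
  multiplicity≤ [] [] u v = z≤n
  multiplicity≤ {T ∷ Ts} (T-tree ∷ trees) (T-disjoint ∷ disjoint) u v with toSum (Subgraph.E? T u v)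
  ... | inj₂ ¬e = ℕ.≤-trans
    (ℕ.≤-reflexive (cong (_+ multiplicity Ts u v) (𝟙-false (Subgraph.E? T u v) ¬e)))
    (multiplicity≤ trees disjoint u v)
  ... | inj₁ e  = ℕ.≤-reflexive (begin
    𝟙 (Subgraph.E? T u v) + multiplicity Ts u v
      ≡⟨ cong₂ _+_ (𝟙-true (Subgraph.E? T u v) e) (multiplicity≡0 (All.map (λ d e′ → d u v (e , e′)) T-disjoint)) ⟩
    1 ≡⟨ 𝟙-true (¬? (u ≟ v)) (IsSubgraph.E⇒~ (IsTreeConnecting.isSub T-tree) u v e) ⟨
    𝟙 (¬? (u ≟ v)) ∎)
    where open ≡-Reasoning

  -- Compares the total weight of the trees with that of all pairs and cancels `m * suc m`, which is
  -- nonzero because k is at least 2.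
  packing≤ : .{{_ : NonZero m}} → ∀ {Ts} → All (IsTreeConnecting (complete n) S) Ts → AllPairs EdgeDisjoint Ts →
    2 * length Ts ≤ suc m + 2 * c
  packing≤ {Ts} trees disjoint = ℕ.*-cancelˡ-≤ (m * suc m) {{ℕ.m*n≢0 m (suc m)}} (begin
    m * suc m * (2 * length Ts)
      ≡⟨ eq (m * suc m) (length Ts) ⟩
    length Ts * (2 * (m * suc m))
      ≤⟨ totalWeight≥ trees ⟩
    sum (λ u → sum λ v → multiplicity Ts u v * W u v)
      ≤⟨ sum-mono (λ u → sum-mono λ v → ℕ.*-monoˡ-≤ (W u v) (multiplicity≤ trees disjoint u v)) ⟩
    sum (λ u → sum λ v → 𝟙 (¬? (u ≟ v)) * W u v)
      ≡⟨ pairTotal ⟩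
    m * suc m * (suc m + 2 * c) ∎)
    where
    open ℕ.≤-Reasoning

    eq : ∀ x p → x * (2 * p) ≡ p * (2 * x)
    eq = solve-∀

-- The generalized connectivity

∈-sublists⇒All : {P : A → Set} {xs ys : List A} → All P xs → ys ∈ₗ sublists xs → All P ys
∈-sublists⇒All []         (here refl) = []
∈-sublists⇒All {xs = x ∷ xs} (px ∷ pxs) ys∈ with ∈-++⁻ (map (x ∷_) (sublists xs)) ys∈
... | inj₂ ys∈′ = ∈-sublists⇒All pxs ys∈′
... | inj₁ x∷∈ with ∈-map⁻ (x ∷_) x∷∈
...   | _ , zs∈ , refl = px ∷ ∈-sublists⇒All pxs zs∈

[]∈sublists : (xs : List A) → [] ∈ₗ sublists xs
[]∈sublists []       = here refl
[]∈sublists (x ∷ xs) = ∈-++⁺ʳ _ ([]∈sublists xs)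

[x]∈sublists : ∀ {x : A} {xs} → x ∈ₗ xs → (x ∷ []) ∈ₗ sublists xs
[x]∈sublists {xs = x ∷ xs} (here refl) = ∈-++⁺ˡ (∈-map⁺ (x ∷_) ([]∈sublists xs))
[x]∈sublists (there x∈)  = ∈-++⁺ʳ _ ([x]∈sublists x∈)

∈-vectors : {xs : List A} → (∀ x → x ∈ₗ xs) → ∀ {m} (v : Vec A m) → v ∈ₗ vectors xs m
∈-vectors complete []      = here refl
∈-vectors complete (x ∷ v) = ∈-cartesianProductWith⁺ _∷_ (complete x) (∈-vectors complete v)

∈-subsets : (S : Subset n) → S ∈ₗ subsets n
∈-subsets = ∈-vectors λ { true → here refl ; false → there (here refl) }

∈-subgraphs : (T : Subgraph n) → T ∈ₗ subgraphs n
∈-subgraphs (subgraph V N) = ∈-cartesianProductWith⁺ subgraph (∈-subsets V) (∈-vectors ∈-subsets N)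

minimum≤ : ∀ {x xs} → x ∈ₗ xs → minimum xs ≤ x
minimum≤ {xs = y ∷ ys} (here refl) = min≤⊤ y ys
minimum≤ {xs = y ∷ ys} (there x∈)  = All.lookup (min≤xs y ys) x∈

minimum≥ : ∀ {v x xs} → x ∈ₗ xs → All (v ≤_) xs → v ≤ minimum xs
minimum≥ {xs = y ∷ ys} _ (v≤y ∷ v≤ys) = v≤min⁺ v≤y v≤ys

-- Shows that the minimum in `κ[ k ]` runs over a nonempty list when `k ≤ n`, and supplies the test
-- set for the upper bound.
subsetOfSize : ∀ {n k} → k ≤ n → ∃[ S ] ∣ S ∣ ≡ k × S ∈ₗ filter (λ (S : Subset n) → ∣ S ∣ ℕ.≟ k) (subsets n)
subsetOfSize {n} {k} k≤n with go k≤n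
  where
  go : ∀ {n k} → k ≤ n → Σ[ S ∈ Subset n ] ∣ S ∣ ≡ k
  go {n} z≤n       = ⊥ , ∣⊥∣≡0 n
  go (s≤s k≤n) with go k≤n
  ... | S , eq = inside ∷ S , cong suc eq
... | S , eq = S , eq , ∈-filter⁺ (λ S → ∣ S ∣ ℕ.≟ k) (∈-subsets S) eq

-- When the maximum is the default `0`, the empty list attains it; hence the premise `P []`.
max-length-attained : {P : List A → Set} (xss : List (List A)) → All P xss → P [] →
  ∃[ xs ] P xs × max 0 (map length xss) ≡ length xs
max-length-attained xss Pxss P[] with argmax-sel id 0 (map length xss)
... | inj₁ max≡0 = [] , P[] , max≡0
... | inj₂ max∈ with ∈-map⁻ length max∈
...   | xs , xs∈ , max≡ = xs , All.lookup Pxss xs∈ , max≡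

module _ (G : Graph n) where

  Packing : Subset n → List (Subgraph n) → Set
  Packing S Ts = All (IsTreeConnecting G S) Ts × AllPairs (InternallyDisjoint S) Ts

  κ-attained : ∀ S → ∃[ Ts ] Packing S Ts × κ G S ≡ length Ts
  κ-attained S = max-length-attained _
    (All.zip (All.filter⁺ packing? (All.tabulate (∈-sublists⇒All (All.all-filter (isTreeConnecting? G S) (subgraphs n))))
             , All.all-filter packing? (sublists (treesConnecting G S))))
    ([] , [])
    where packing? = allPairs? (internallyDisjoint? S)

  -- A single tree is already a packing, as there is no pair to compare.
  κ≥1 : ∀ {S T} → IsTreeConnecting G S T → 1 ≤ κ G S
  κ≥1 {S} {T} T-tree = All.lookup (xs≤max 0 _)
    (∈-map⁺ length (∈-filter⁺ (allPairs? (internallyDisjoint? S))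
      ([x]∈sublists (∈-filter⁺ (isTreeConnecting? G S) (∈-subgraphs T) T-tree)) ([] ∷ [])))

  κ[]≤κ : ∀ {k S} → S ∈ₗ filter (λ S → ∣ S ∣ ℕ.≟ k) (subsets n) → κ[ k ] G ≤ κ G S
  κ[]≤κ S∈ = ℕ.≤-trans (if≤ (does (connected? (Graph._~?_ G) ⊤))) (minimum≤ (∈-map⁺ (κ G) S∈))
    where
    if≤ : ∀ b {x} → (if b then x else 0) ≤ x
    if≤ true  = ℕ.≤-refl
    if≤ false = z≤n

-- The same spanning tree, rooted at `zero`, gives `1 ≤ κ G S` for all `S`, hence for the minimum.
κ[]≥1 : ∀ {k} (G : Graph (suc n)) → k ≤ suc n → Connected (Graph._~_ G) ⊤ → 1 ≤ κ[ k ] G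
κ[]≥1 G k≤n connected = ≤if (dec-true (connected? (Graph._~?_ G) ⊤) connected)
  (minimum≥ (∈-map⁺ (κ G) (proj₂ (proj₂ (subsetOfSize k≤n))))
    (All.map⁺ (All.tabulate λ {S} _ → κ≥1 G (spanningTree-connecting G connected zero S))))
  where
  ≤if : ∀ {b x} → b ≡ true → 1 ≤ x → 1 ≤ (if b then x else 0)
  ≤if refl 1≤x = 1≤x

-- Bounds on the sum and the product

IsTreeConnecting-complete : (G : Graph n) → ∀ {S T} → IsTreeConnecting G S T → IsTreeConnecting (complete n) S T
IsTreeConnecting-complete G (isTreeConnecting (isSubgraph s v e) tree covers) =
  isTreeConnecting (isSubgraph s v λ x y xy x≡y → Graph.~-irrefl G x≡y (e x y xy)) tree covers

-- Integrality supplies the rounding: `k` is at most `2 * ⌊ k /2⌋ + 1`, so `2 * p` exceeds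
-- `2 * (⌊ k /2⌋ + c)` by at most one, and `p` cannot exceed `⌊ k /2⌋ + c`.
halve : ∀ p k c → 2 * p ≤ k + 2 * c → p ≤ (k + c) ∸ ⌈ k /2⌉
halve p k c 2p≤ = begin
  p                                     ≤⟨ ℕ.≮⇒≥ (λ f+c<p → ℕ.<-irrefl refl (ℕ.<-≤-trans (odd< f+c<p) 2p≤odd)) ⟩
  ⌊ k /2⌋ + c                           ≡⟨ ℕ.m+n∸n≡m (⌊ k /2⌋ + c) ⌈ k /2⌉ ⟨
  (⌊ k /2⌋ + c + ⌈ k /2⌉) ∸ ⌈ k /2⌉     ≡⟨ cong (_∸ ⌈ k /2⌉) (rotate ⌊ k /2⌋ c ⌈ k /2⌉) ⟩
  (⌊ k /2⌋ + ⌈ k /2⌉ + c) ∸ ⌈ k /2⌉     ≡⟨ cong (λ x → x + c ∸ ⌈ k /2⌉) (ℕ.⌊n/2⌋+⌈n/2⌉≡n k) ⟩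
  (k + c) ∸ ⌈ k /2⌉                     ∎
  where
  open ℕ.≤-Reasoning

  rotate : ∀ a b c → a + b + c ≡ a + c + b
  rotate = solve-∀

  odd : ∀ f c → f + suc f + 2 * c ≡ suc (2 * (f + c))
  odd = solve-∀

  2p≤odd : 2 * p ≤ suc (2 * (⌊ k /2⌋ + c))
  2p≤odd = begin
    2 * p                           ≤⟨ 2p≤ ⟩
    k + 2 * c                       ≡⟨ cong (_+ 2 * c) (ℕ.⌊n/2⌋+⌈n/2⌉≡n k) ⟨
    -- `⌈ k /2⌉` unfolds to `⌊ suc k /2⌋`, and `⌊ suc (suc k) /2⌋` to `suc ⌊ k /2⌋`.
    ⌊ k /2⌋ + ⌈ k /2⌉ + 2 * c       ≤⟨ ℕ.+-monoˡ-≤ (2 * c) (ℕ.+-monoʳ-≤ ⌊ k /2⌋ (ℕ.⌊n/2⌋-mono (ℕ.n≤1+n (suc k)))) ⟩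
    ⌊ k /2⌋ + suc ⌊ k /2⌋ + 2 * c   ≡⟨ odd ⌊ k /2⌋ c ⟩
    suc (2 * (⌊ k /2⌋ + c))         ∎

  odd< : ∀ {q} → q < p → suc (2 * q) < 2 * p
  odd< {q} q<p = ℕ.≤-trans (ℕ.≤-reflexive (sym (ℕ.*-suc 2 q))) (ℕ.*-monoʳ-≤ 2 q<p)

-- Optimal packings of `G` and of its complement are concatenated. Trees from different packings are
-- edge disjoint because no pair is adjacent in both graphs.
κ+κ≤ : (G : Graph n) (S : Subset n) → ∀ {m} .{{_ : NonZero m}} → ∣ S ∣ ≡ suc m → suc m ≤ n →
  κ G S + κ (complement G) S ≤ n ∸ ⌈ suc m /2⌉
κ+κ≤ {n} G S {m} ∣S∣≡ m<n = combine (κ-attained G S) (κ-attained (complement G) S)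
  where
  -- The two values are abstracted as `a` and `b`, so that matching on `refl` replaces them by
  -- lengths.
  combine : ∀ {a b} → ∃[ Ts ] Packing G S Ts × a ≡ length Ts → ∃[ Ts ] Packing (complement G) S Ts × b ≡ length Ts →
            a + b ≤ n ∸ ⌈ suc m /2⌉
  combine (Ts , (trees , disjoint) , refl) (Ts′ , (trees′ , disjoint′) , refl) = begin
    length Ts + length Ts′             ≡⟨ length-++ Ts ⟨
    length (Ts ++ Ts′)                 ≤⟨ halve (length (Ts ++ Ts′)) (suc m) (n ∸ suc m) bound ⟩
    suc m + (n ∸ suc m) ∸ ⌈ suc m /2⌉  ≡⟨ cong (_∸ ⌈ suc m /2⌉) (ℕ.m+[n∸m]≡n m<n) ⟩
    n ∸ ⌈ suc m /2⌉                    ∎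
    where
    open ℕ.≤-Reasoning

    separate : All (λ T → All (EdgeDisjoint T) Ts′) Ts
    separate = All.map (λ t → All.map (λ t′ u v (e , e′) →
      proj₂ (IsSubgraph.E⇒~ (IsTreeConnecting.isSub t′) u v e′) (IsSubgraph.E⇒~ (IsTreeConnecting.isSub t) u v e))
      trees′) trees

    bound : 2 * length (Ts ++ Ts′) ≤ suc m + 2 * (n ∸ suc m)
    bound = Counting.packing≤ S m (n ∸ suc m) ∣S∣≡ (sym (ℕ.m+[n∸m]≡n m<n))
      (All.++⁺ (All.map (IsTreeConnecting-complete G) trees) (All.map (IsTreeConnecting-complete (complement G)) trees′))
      (AllPairs.++⁺ (AllPairs.map proj₁ disjoint) (AllPairs.map proj₁ disjoint′) separate)

-- For `b` equal to `a + d` the two sides differ by `d * d`.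
4ab≤[a+b]² : ∀ a b → 4 * (a * b) ≤ (a + b) * (a + b)
4ab≤[a+b]² a b = ≤-case (ℕ.≤-total a b)
  where
  eq : ∀ a d → 4 * (a * (a + d)) + d * d ≡ (a + (a + d)) * (a + (a + d))
  eq = solve-∀

  ordered : ∀ {a b} → a ≤ b → 4 * (a * b) ≤ (a + b) * (a + b)
  ordered {a} a≤b with ℕ.m≤n⇒∃[o]m+o≡n a≤b
  ... | d , refl = ℕ.≤-trans (ℕ.m≤m+n _ (d * d)) (ℕ.≤-reflexive (eq a d))

  ≤-case : a ≤ b ⊎ b ≤ a → 4 * (a * b) ≤ (a + b) * (a + b)
  ≤-case (inj₁ a≤b) = ordered a≤b
  ≤-case (inj₂ b≤a) = subst₂ _≤_ (cong (4 *_) (ℕ.*-comm b a)) (cong (λ x → x * x) (ℕ.+-comm b a)) (ordered b≤a)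

-- Below, whichever of the two graphs is connected contributes at least 1. Above, one and the same
-- `S` bounds both minima.
sumBounds : ∀ {n k} → 2 ≤ k → k ≤ n → (G : Graph n) →
  1 ≤ κ[ k ] G + κ[ k ] (complement G) × κ[ k ] G + κ[ k ] (complement G) ≤ n ∸ ⌈ k /2⌉
sumBounds {zero}      (s≤s _) ()
sumBounds {n@(suc _)} {k@(suc (suc _))} (s≤s (s≤s _)) k≤n G = lower (connectedOrComplement G) , upper
  where
  lower : Connected (Graph._~_ G) ⊤ ⊎ Connected (Graph._~_ (complement G)) ⊤ → 1 ≤ κ[ k ] G + κ[ k ] (complement G)
  lower (inj₁ c) = ℕ.≤-trans (κ[]≥1 G k≤n c) (ℕ.m≤m+n _ _)
  lower (inj₂ c) = ℕ.≤-trans (κ[]≥1 (complement G) k≤n c) (ℕ.m≤n+m _ _)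

  upper : κ[ k ] G + κ[ k ] (complement G) ≤ n ∸ ⌈ k /2⌉
  upper = let S , ∣S∣≡k , S∈ = subsetOfSize k≤n in
    ℕ.≤-trans (ℕ.+-mono-≤ (κ[]≤κ G S∈) (κ[]≤κ (complement G) S∈)) (κ+κ≤ G S ∣S∣≡k k≤n)

-- On unnormalised fractions the claim is a cross-multiplication. `mkℚᵘ` stores the denominator
-- minus one, so `mkℚᵘ (+ y) 1` is y / 2.
/1≤/2*/2 : ∀ x y → 4 * x ≤ y * y → (+ x / 1) ℚ.≤ (+ y / 2) ℚ.* (+ y / 2)
/1≤/2*/2 x y 4x≤ = ℚ.toℚᵘ-cancel-≤ (begin
  ℚ.toℚᵘ (+ x / 1)                      ≃⟨ ℚ.toℚᵘ-fromℚᵘ (ℚᵘ.mkℚᵘ (+ x) 0) ⟩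
  ℚᵘ.mkℚᵘ (+ x) 0                       ≤⟨ ℚᵘ.*≤* ineq ⟩
  ℚᵘ.mkℚᵘ (+ y) 1 ℚᵘ.* ℚᵘ.mkℚᵘ (+ y) 1  ≃⟨ ℚᵘ.*-cong (ℚ.toℚᵘ-fromℚᵘ (ℚᵘ.mkℚᵘ (+ y) 1)) (ℚ.toℚᵘ-fromℚᵘ (ℚᵘ.mkℚᵘ (+ y) 1)) ⟨
  ℚ.toℚᵘ (+ y / 2) ℚᵘ.* ℚ.toℚᵘ (+ y / 2) ≃⟨ ℚ.toℚᵘ-homo-* (+ y / 2) (+ y / 2) ⟨
  ℚ.toℚᵘ ((+ y / 2) ℚ.* (+ y / 2))      ∎)
  where
  open ℚᵘ.≤-Reasoning
  ineq : + x ℤ.* + 4 ℤ.≤ (+ y ℤ.* + y) ℤ.* + 1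
  ineq = subst₂ ℤ._≤_
    (trans (cong +_ (ℕ.*-comm 4 x)) (ℤ.pos-* x 4))
    (trans (ℤ.pos-* y y) (sym (ℤ.*-identityʳ _)))
    (ℤ.+≤+ 4x≤)

-- Tightness

path₄ : Graph 4
path₄ = record
  { _~_      = λ u v → suc (toℕ u) ≡ toℕ v ⊎ suc (toℕ v) ≡ toℕ u
  ; _~?_     = λ u v → (suc (toℕ u) ℕ.≟ toℕ v) ⊎-dec (suc (toℕ v) ℕ.≟ toℕ u)
  ; ~-sym    = swap
  ; ~-irrefl = λ { refl (inj₁ eq) → ℕ.1+n≢n eq ; refl (inj₂ eq) → ℕ.1+n≢n eq }
  }

path₄-connected : Connected (Graph._~_ path₄) ⊤
path₄-connected = from-yes (connected? (Graph._~?_ path₄) ⊤)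

path₄-coconnected : Connected (Graph._~_ (complement path₄)) ⊤
path₄-coconnected = from-yes (connected? (Graph._~?_ (complement path₄)) ⊤)

-- Avoids evaluating `κ[ k ]`: both values are at least 1 by connectedness and their sum is at most
-- 2, so both are 1.
productAttained : ∀ {n k} → 2 ≤ k → k ≤ n → (G : Graph n) →
  Connected (Graph._~_ G) ⊤ → Connected (Graph._~_ (complement G)) ⊤ → n ∸ ⌈ k /2⌉ ≡ 2 →
  (+ (κ[ k ] G * κ[ k ] (complement G)) / 1) ≡ (+ (n ∸ ⌈ k /2⌉) / 2) ℚ.* (+ (n ∸ ⌈ k /2⌉) / 2)
productAttained {zero} (s≤s _) ()
productAttained {suc n} {k} 2≤k k≤n G connected coconnected ≡2 =
  trans (cong (λ x → + x / 1) (≡1 (κ[ k ] G) (κ[ k ] (complement G))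
           (κ[]≥1 {k = k} G k≤n connected) (κ[]≥1 {k = k} (complement G) k≤n coconnected)
           (ℕ.≤-trans (proj₂ (sumBounds 2≤k k≤n G)) (ℕ.≤-reflexive ≡2))))
        -- The sides to be joined, `+ 1 / 1` and the square of `+ 2 / 2`, compute to the same
        -- rational.
        (cong (λ x → (+ x / 2) ℚ.* (+ x / 2)) (sym ≡2))
  where
  ≡1 : ∀ a b → 1 ≤ a → 1 ≤ b → a + b ≤ 2 → a * b ≡ 1
  ≡1 1             1             _ _ _ = refl
  ≡1 1             (suc (suc _)) _ _ (s≤s (s≤s ()))
  ≡1 (suc (suc a)) (suc b)       _ _ (s≤s (s≤s a+1+b≤0)) =
    contradiction (trans (sym (ℕ.+-suc a b)) (ℕ.n≤0⇒n≡0 a+1+b≤0)) λ ()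

module _ (G : Graph 2) where

  -- Here `2 ∸ ⌈ 2 /2⌉` computes to 1, so the lower and upper bounds meet for every graph on two
  -- vertices.
  κ+κ≡1 : κ[ 2 ] G + κ[ 2 ] (complement G) ≡ 1
  κ+κ≡1 = let lower , upper = sumBounds ℕ.≤-refl ℕ.≤-refl G in ℕ.≤-antisym upper lower

  κ*κ≡0 : κ[ 2 ] G * κ[ 2 ] (complement G) ≡ 0
  κ*κ≡0 = m+n≡1⇒m*n≡0 (κ[ 2 ] G) (κ[ 2 ] (complement G)) κ+κ≡1
    where
    m+n≡1⇒m*n≡0 : ∀ m n → m + n ≡ 1 → m * n ≡ 0
    m+n≡1⇒m*n≡0 zero       n    _ = refl
    m+n≡1⇒m*n≡0 (suc zero) zero _ = refl

theorem6 : (∀ (n k : ℕ) → 2 ≤ k → k ≤ n → (G : Graph n) →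
    (1 ≤ κ[ k ] G + κ[ k ] (complement G) ×
    κ[ k ] G + κ[ k ] (complement G) ≤ n ∸ ⌈ k /2⌉) ×
    (0 ≤ κ[ k ] G * κ[ k ] (complement G) ×
    (+ (κ[ k ] G * κ[ k ] (complement G)) / 1)
    ℚ.≤ (+ (n ∸ ⌈ k /2⌉) / 2) ℚ.* (+ (n ∸ ⌈ k /2⌉) / 2))) ×
    (∃[ n ] ∃[ k ] 2 ≤ k × k ≤ n × Σ[ G ∈ Graph n ]
    1 ≡ κ[ k ] G + κ[ k ] (complement G)) ×
    (∃[ n ] ∃[ k ] 2 ≤ k × k ≤ n × Σ[ G ∈ Graph n ]
    κ[ k ] G + κ[ k ] (complement G) ≡ n ∸ ⌈ k /2⌉) ×
    (∃[ n ] ∃[ k ] 2 ≤ k × k ≤ n × Σ[ G ∈ Graph n ]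
    0 ≡ κ[ k ] G * κ[ k ] (complement G)) ×
    (∃[ n ] ∃[ k ] 2 ≤ k × k ≤ n × Σ[ G ∈ Graph n ]
    (+ (κ[ k ] G * κ[ k ] (complement G)) / 1)
    ≡ (+ (n ∸ ⌈ k /2⌉) / 2) ℚ.* (+ (n ∸ ⌈ k /2⌉) / 2))
theorem6 =
  (λ n k 2≤k k≤n G → let lower , upper = sumBounds 2≤k k≤n G in
    (lower , upper) ,
    (z≤n , /1≤/2*/2 (κ[ k ] G * κ[ k ] (complement G)) (n ∸ ⌈ k /2⌉)
             -- Four times the product is at most the square of the sum, to which the upper bound on
             -- the sum applies.
             (ℕ.≤-trans (4ab≤[a+b]² (κ[ k ] G) (κ[ k ] (complement G))) (ℕ.*-mono-≤ upper upper)))) ,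
  (2 , 2 , ℕ.≤-refl , ℕ.≤-refl , complete 2 , sym (κ+κ≡1 (complete 2))) ,
  (2 , 2 , ℕ.≤-refl , ℕ.≤-refl , complete 2 , κ+κ≡1 (complete 2)) ,
  (2 , 2 , ℕ.≤-refl , ℕ.≤-refl , complete 2 , sym (κ*κ≡0 (complete 2))) ,
  -- The final `refl` checks that `4 ∸ ⌈ 3 /2⌉` is 2.
  (4 , 3 , s≤s (s≤s z≤n) , ℕ.n≤1+n 3 , path₄ ,
    productAttained {4} {3} (s≤s (s≤s z≤n)) (ℕ.n≤1+n 3) path₄ path₄-connected path₄-coconnected refl)
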